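{- There exists an algorithm in the hybrid setting, drawing only uniform samples and having no information about $n=|U|$, that for every instance $(U,w)$ with $n=|U|\ge2$ has expected sample complexity $O(n\log n)$ (with an absolute implied constant) and returns, with probability at least $2/3$, the whole set $U$ (together with the weights of its items, so that $\sum_{a\in U}w(a)$ is then known exactly).
   Context: An instance $(U,w)$ consists of a finite set $U$ and a weight function $w:U\to[0,\infty)$; $W=\sum_{a\in U}w(a)$. Hybrid setting: a (randomized, adaptive) algorithm can interact with the instance only by (1) drawing an independent proportional sample, which returns $(a,w(a))$ where item $a$ is returned with probability $w(a)/W$; (2) testing, for two sampled items $a,a'$, whether $a=a'$; (3) drawing an independent uniform sample, which returns $(a,w(a))$ where each item $a\in U$ is returned with probability $1/|U|$. The sample complexity is the total number of samples drawn. -}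

module Defs where

open import Algebra.Properties.CommutativeMonoid.Sum using (sum)
open import Data.Bool using (Bool; true; false; T; if_then_else_)
open import Data.Fin using (Fin)
import Data.Fin.Properties as Fin
open import Data.Integer using (+_)
open import Data.List using (List; foldr; map; tabulate)
open import Data.List.Membership.Propositional using (_∈_)
open import Data.List.Relation.Unary.All using (All)
open import Data.List.Relation.Unary.Unique.Propositional using (Unique)
open import Data.Nat as ℕ using (ℕ; zero; suc; _⊔_)
import Data.Nat.Properties as ℕ
open import Data.Product using (Σ; ∃-syntax; _×_; _,_; proj₁; proj₂)
open import Data.Rational
  using (ℚ; 0ℚ; 1ℚ; ½; _+_; _-_; _*_; -_; _/_; ∣_∣; _<_; _≤_)
import Data.Rational.Properties as ℚ
open import Data.Rational.Solver using (module +-*-Solver)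
open import Data.Vec using (Vec; []; _∷_; lookup)
open import Function using (_∘_; _↔_; Inverse)
open import Relation.Binary.PropositionalEquality
  using (_≡_; refl; sym; subst; subst₂)
open import Relation.Nullary.Decidable using (⌊_⌋)

-- Real numbers as Cauchy sequences of rationals.  The existential in each
-- definition is a Σ-type, so it carries a modulus.

record ℝ : Set where
  constructor mkℝ
  field
    approx : ℕ → ℚ
    cauchy : ∀ ε → 0ℚ < ε →
             ∃[ N ] (∀ m n → N ℕ.≤ m → N ℕ.≤ n → ∣ approx m - approx n ∣ < ε)

open ℝ public

infix 4 _≃_

_≃_ : ℝ → ℝ → Set
x ≃ y = ∀ ε → 0ℚ < ε → ∃[ N ] (∀ n → N ℕ.≤ n → ∣ approx x n - approx y n ∣ < ε)

NonNegative : ℝ → Set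
NonNegative x = ∀ ε → 0ℚ < ε → ∃[ N ] (∀ n → N ℕ.≤ n → - ε < approx x n)

0ℝ : ℝ
approx 0ℝ _ = 0ℚ
cauchy 0ℝ ε 0<ε = 0 , λ _ _ _ _ → 0<ε

infixl 6 _+ℝ_

_+ℝ_ : ℝ → ℝ → ℝ
approx (x +ℝ y) n = approx x n + approx y n
cauchy (x +ℝ y) ε 0<ε
  with 0<ε/2 ← subst (_< ½ * ε) (ℚ.*-zeroʳ ½) (ℚ.*-monoʳ-<-pos ½ 0<ε)
  with M , p ← cauchy x (½ * ε) 0<ε/2 | N , q ← cauchy y (½ * ε) 0<ε/2
  = M ⊔ N , λ m n M⊔N≤m M⊔N≤n →
      subst₂ (λ a b → ∣ a ∣ < b)
        (rearrange (approx x m) (approx x n) (approx y m) (approx y n)) halves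
        (ℚ.≤-<-trans (ℚ.∣p+q∣≤∣p∣+∣q∣ (approx x m - approx x n) (approx y m - approx y n))
          (ℚ.+-mono-< (p m n (ℕ.m⊔n≤o⇒m≤o M N M⊔N≤m) (ℕ.m⊔n≤o⇒m≤o M N M⊔N≤n))
                      (q m n (ℕ.m⊔n≤o⇒n≤o M N M⊔N≤m) (ℕ.m⊔n≤o⇒n≤o M N M⊔N≤n))))
  where
  open +-*-Solver using (solve; _:+_; _:-_; _:=_)
  rearrange : ∀ a b c d → (a - b) + (c - d) ≡ (a + c) - (b + d)
  rearrange = solve 4 (λ a b c d → (a :- b) :+ (c :- d) := (a :+ c) :- (b :+ d)) refl
  halves : ½ * ε + ½ * ε ≡ ε
  halves rewrite sym (ℚ.*-distribʳ-+ ε ½ ½) = ℚ.*-identityˡ ε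

sumℝ : List ℝ → ℝ
sumℝ = foldr _+ℝ_ 0ℝ

record Instance : Set₁ where
  field
    U           : Set
    size        : ℕ
    enum        : Fin size ↔ U
    weight      : U → ℝ
    nonNegative : ∀ a → NonNegative (weight a)

  item : Fin size → U
  item = Inverse.to enum

  sameItem : U → U → Bool
  sameItem a b = ⌊ Inverse.from enum a Fin.≟ Inverse.from enum b ⌋

  totalWeight : ℝ
  totalWeight = sumℝ (tabulate (weight ∘ item))

open Instance public using (size)

data Source : Set where
  proportional uniform : Source

-- What an algorithm that has drawn k samples does next, when it may draw from
-- the sources satisfying A.  Items are opaque: the algorithm receives only the
-- weight of a sample and refers to its item by an index in Fin k, where zero is
-- the most recent sample.  A returned list pairs sampled items with weights.

data Action (A : Source → Set) (State : ℕ → Set) (k : ℕ) : Set where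
  draw   : ∀ s → A s → (ℝ → State (suc k)) → Action A State k
  test   : (i j : Fin k) → (Bool → State k) → Action A State k
  flip   : (Bool → State k) → Action A State k
  return : List (Fin k × ℝ) → Action A State k

record Algorithm (A : Source → Set) : Set₁ where
  field
    State : ℕ → Set
    start : State 0
    next  : ∀ {k} → State k → Action A State k

UniformOnly : Source → Set
UniformOnly s = s ≡ uniform

module Execution (𝒜 : Algorithm UniformOnly) (I : Instance) where
  open Algorithm 𝒜
  open Instance I hiding (size)

  record Config : Set where
    constructor config
    field
      {drawn} : ℕ
      samples : Vec U drawn
      state   : State drawn

  open Config public

  -- The randomness available to one step: a uniform item and an independent
  -- fair coin.  A step ignores whichever it does not ask for.

  Seed : Set
  Seed = U × Bool

  -- A configuration whose next action is `return` has halted.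

  step : Config → Seed → Config
  step c@(config as σ) (a , b) with next σ
  ... | draw _ refl f = config (a ∷ as) (f (weight a))
  ... | test i j f    = config as (f (sameItem (lookup as i) (lookup as j)))
  ... | flip f        = config as (f b)
  ... | return _      = c

  runFrom : ∀ {t} → Config → Vec Seed t → Config
  runFrom c []      = c
  runFrom c (s ∷ ω) = runFrom (step c s) ω

  run : ∀ {t} → Vec Seed t → Config
  run = runFrom (config [] start)

  -- Expectation over t independent seeds.  The mean over an empty range is
  -- set to 0; it does not occur when U is nonempty.

  mean : ∀ {n} → (Fin n → ℚ) → ℚ
  mean {zero}  _ = 0ℚ
  mean {suc m} f = (+ 1 / suc m) * sum ℚ.+-0-commutativeMonoid f

  𝔼 : ∀ t → (Vec Seed t → ℚ) → ℚ
  𝔼 zero    f = f []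
  𝔼 (suc t) f = mean λ i →
    ½ * (𝔼 t (λ ω → f ((item i , true) ∷ ω)) + 𝔼 t (λ ω → f ((item i , false) ∷ ω)))

  -- The number of samples drawn within t steps increases with t to the total
  -- number drawn, so by monotone convergence the expected total is at most B
  -- iff every one of these expectations is.

  ExpectedSamples≤ : ℕ → Set
  ExpectedSamples≤ B = ∀ t → 𝔼 t (λ ω → + drawn (run ω) / 1) ≤ + B / 1

  -- For a property P of configurations that, once it holds, persists, this says
  -- that P is eventually reached with probability at least p: the probability is
  -- the supremum over t of that of P (run ω).  Since P need not be decidable, the
  -- event at time t is bounded below by a Boolean event D contained in it.

  EventuallyWithProbability≥ : ℚ → (Config → Set) → Set
  EventuallyWithProbability≥ p P =
    ∀ ε → 0ℚ < ε → ∃[ t ] Σ (Vec Seed t → Bool) λ D →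
      (∀ ω → T (D ω) → P (run ω)) ×
      p - ε ≤ 𝔼 t (λ ω → if D ω then 1ℚ else 0ℚ)

  record IsWholeSet (xs : List (U × ℝ)) : Set where
    field
      unique   : Unique (map proj₁ xs)
      complete : ∀ a → a ∈ map proj₁ xs
      weights  : All (λ (a , x) → x ≃ weight a) xs
      total    : sumℝ (map proj₂ xs) ≃ totalWeight

  ReturnsWholeSet : Config → Set
  ReturnsWholeSet (config as σ) = ∃[ out ]
    next σ ≡ return out × IsWholeSet (map (λ (i , x) → lookup as i , x) out)

{-# OPTIONS --safe #-}

-- The algorithm keeps the distinct items found so far and stops after k draws
-- as soon as k ≥ threshold d, where d is the number of distinct items found.
-- Since d ≤ n, it never draws more than threshold n = O(n log n) samples.
--
-- It errs only by stopping with d < n.  The pair (k , d) is a Markov chain, and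
-- two nonnegative functions of it do not increase in expectation:
--   * (1/2)^d (4/3)^k, cut off to 0 once 2d > n, because while 2d ≤ n a draw is
--     new with probability at least 1/2;
--   * (n - d) (n/(n-1))^k, because each missing item survives a draw with
--     probability (n-1)/n.
-- Normalised to start at 1/8 each, one of them is at least 1 whenever the
-- algorithm errs, so it errs with probability at most 1/4.

module Submission where

open import Defs
open import Data.Integer as ℤ using (+_)
import Data.Integer.Properties as ℤ
open import Algebra.Bundles using (CommutativeRing)
import Algebra.Properties.CommutativeMonoid.Sum as Sum
import Algebra.Properties.Semiring.Exp as Exp
open import Data.Bool using (Bool; true; false; T; if_then_else_; _∧_)
open import Data.Fin as Fin using (Fin; zero; suc)
import Data.Fin.Properties as Fin
open import Data.List using (List; []; _∷_; length; map; foldr; tabulate; lookup)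
import Data.List.Membership.DecPropositional as DecMembership
open import Data.List.Membership.Propositional using (_∈_)
import Data.List.Membership.Propositional.Properties as ∈
open import Data.List.Membership.Propositional.Properties.WithK using (unique∧set⇒bag)
import Data.List.Properties as List
open import Data.List.Relation.Binary.BagAndSetEquality using (∼bag⇒↭)
open import Data.List.Relation.Binary.Permutation.Propositional using (_↭_; ↭⇒↭ₛ)
import Data.List.Relation.Binary.Permutation.Propositional.Properties as ↭
open import Data.List.Relation.Binary.Permutation.Setoid.Properties using (foldr-commMonoid)
open import Data.List.Relation.Unary.All as All using (All; []; _∷_)
import Data.List.Relation.Unary.All.Properties as All
open import Data.List.Relation.Unary.Unique.Propositional using (Unique; []; _∷_)
import Data.List.Relation.Unary.Unique.Propositional.Properties as Unique
open import Data.Nat as ℕ using (ℕ; zero; suc; NonZero; z≤n; s≤s; _∸_)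
open import Data.Nat.Logarithm using (⌊log₂_⌋; ⌊log₂⌋-mono-≤; ⌊log₂[2^n]⌋≡n)
import Data.Nat.Properties as ℕ
import Data.Nat.Solver
open import Data.Product using (Σ; ∃-syntax; _×_; _,_; proj₁; proj₂)
open import Data.Rational
  using (ℚ; 0ℚ; 1ℚ; ½; _+_; _-_; _*_; -_; _/_; ∣_∣; _<_; _≤_; Positive; toℚᵘ; nonNegative)
import Data.Rational.Properties as ℚ
open import Data.Rational.Solver using (module +-*-Solver)
import Data.Rational.Unnormalised as ℚᵘ
import Data.Rational.Unnormalised.Properties as ℚᵘ
open import Data.Vec as Vec using (Vec; []; _∷_)
open import Function using (_∘_; mk⇔; Inverse)
open import Relation.Binary.PropositionalEquality
  using (_≡_; refl; sym; trans; cong; cong₂; subst; subst₂; setoid; module ≡-Reasoning)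
open import Relation.Nullary using (¬_; Dec; yes; no; does; contradiction)
open import Relation.Nullary.Decidable using (toWitness; ⌊_⌋)

open Exp (CommutativeRing.semiring ℚ.+-*-commutativeRing) using (_^_; ^-homo-*; ^-assocʳ)

module N = Data.Nat.Solver.+-*-Solver

-- Naturals embedded in the rationals, and growth of powers.

ι : ℕ → ℚ
ι n = + n / 1

ι-+ : ∀ a b → ι (a ℕ.+ b) ≡ ι a + ι b
ι-+ a b = ℚ.toℚᵘ-injective (begin
  toℚᵘ (ι (a ℕ.+ b))                ≈⟨ ℚ.toℚᵘ-fromℚᵘ (ℚᵘ.mkℚᵘ (+ (a ℕ.+ b)) 0) ⟩
  ℚᵘ.mkℚᵘ (+ (a ℕ.+ b)) 0           ≡⟨ cong (λ z → ℚᵘ.mkℚᵘ z 0)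
                                         (sym (cong₂ ℤ._+_ (ℤ.*-identityʳ (+ a)) (ℤ.*-identityʳ (+ b)))) ⟩
  ℚᵘ.mkℚᵘ (+ a) 0 ℚᵘ.+ ℚᵘ.mkℚᵘ (+ b) 0
    ≈⟨ ℚᵘ.+-cong (ℚᵘ.≃-sym (ℚ.toℚᵘ-fromℚᵘ (ℚᵘ.mkℚᵘ (+ a) 0))) (ℚᵘ.≃-sym (ℚ.toℚᵘ-fromℚᵘ (ℚᵘ.mkℚᵘ (+ b) 0))) ⟩
  toℚᵘ (ι a) ℚᵘ.+ toℚᵘ (ι b)        ≈⟨ ℚᵘ.≃-sym (ℚ.toℚᵘ-homo-+ (ι a) (ι b)) ⟩
  toℚᵘ (ι a + ι b)                  ∎)
  where open ℚᵘ.≃-Reasoning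

ι-* : ∀ a b → ι (a ℕ.* b) ≡ ι a * ι b
ι-* zero    b = sym (ℚ.*-zeroˡ (ι b))
ι-* (suc a) b = begin
  ι (b ℕ.+ a ℕ.* b)      ≡⟨ ι-+ b (a ℕ.* b) ⟩
  ι b + ι (a ℕ.* b)      ≡⟨ cong₂ _+_ (sym (ℚ.*-identityˡ (ι b))) (ι-* a b) ⟩
  1ℚ * ι b + ι a * ι b   ≡⟨ ℚ.*-distribʳ-+ (ι b) 1ℚ (ι a) ⟨
  (1ℚ + ι a) * ι b       ≡⟨ cong (_* ι b) (ι-+ 1 a) ⟨
  ι (suc a) * ι b        ∎
  where open ≡-Reasoning

ι-nonNeg : ∀ n → 0ℚ ≤ ι n
ι-nonNeg n = ℚ.nonNegative⁻¹ _ {{ℚ.normalize-nonNeg n 1}}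

ι-mono-≤ : ∀ {a b} → a ℕ.≤ b → ι a ≤ ι b
ι-mono-≤ {a} {b} a≤b = begin
  ι a                ≡⟨ ℚ.+-identityʳ (ι a) ⟨
  ι a + 0ℚ           ≤⟨ ℚ.+-monoʳ-≤ (ι a) (ι-nonNeg (b ∸ a)) ⟩
  ι a + ι (b ∸ a)    ≡⟨ ι-+ a (b ∸ a) ⟨
  ι (a ℕ.+ (b ∸ a))  ≡⟨ cong ι (ℕ.m+[n∸m]≡n a≤b) ⟩
  ι b                ∎
  where open ℚ.≤-Reasoning

1/n*ιn : ∀ n .{{_ : NonZero n}} → (+ 1 / n) * ι n ≡ 1ℚ
1/n*ιn n@(suc m) = ℚ.toℚᵘ-injective (begin
  toℚᵘ ((+ 1 / n) * ι n)                  ≈⟨ ℚ.toℚᵘ-homo-* (+ 1 / n) (ι n) ⟩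
  toℚᵘ (+ 1 / n) ℚᵘ.* toℚᵘ (ι n)
    ≈⟨ ℚᵘ.*-cong (ℚ.toℚᵘ-fromℚᵘ (ℚᵘ.mkℚᵘ (+ 1) m)) (ℚ.toℚᵘ-fromℚᵘ (ℚᵘ.mkℚᵘ (+ n) 0)) ⟩
  ℚᵘ.mkℚᵘ (+ 1) m ℚᵘ.* ℚᵘ.mkℚᵘ (+ n) 0    ≈⟨ ℚᵘ.*≡* (ℤ.*-assoc (+ 1) (+ n) (+ 1)) ⟩
  toℚᵘ 1ℚ                                 ∎)
  where open ℚᵘ.≃-Reasoning

1/n-nonNeg : ∀ n .{{_ : NonZero n}} → 0ℚ ≤ + 1 / n
1/n-nonNeg n = ℚ.nonNegative⁻¹ _ {{ℚ.normalize-nonNeg 1 n}}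

*-monoˡ : ∀ {x a b} → 0ℚ ≤ x → a ≤ b → x * a ≤ x * b
*-monoˡ {x} 0≤x = ℚ.*-monoˡ-≤-nonNeg x {{nonNegative 0≤x}}

*-monoʳ : ∀ {x a b} → 0ℚ ≤ x → a ≤ b → a * x ≤ b * x
*-monoʳ {x} 0≤x = ℚ.*-monoʳ-≤-nonNeg x {{nonNegative 0≤x}}

*-nonNeg : ∀ {x y} → 0ℚ ≤ x → 0ℚ ≤ y → 0ℚ ≤ x * y
*-nonNeg {x} {y} 0≤x 0≤y = subst (_≤ x * y) (ℚ.*-zeroʳ x) (*-monoˡ 0≤x 0≤y)

^-nonNeg : ∀ {x} → 0ℚ ≤ x → ∀ n → 0ℚ ≤ x ^ n
^-nonNeg 0≤x zero    = ι-nonNeg 1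
^-nonNeg 0≤x (suc n) = *-nonNeg 0≤x (^-nonNeg 0≤x n)

^-≥1 : ∀ {x} → 1ℚ ≤ x → ∀ n → 1ℚ ≤ x ^ n
^-≥1 1≤x zero    = ℚ.≤-refl
^-≥1 {x} 1≤x (suc n) = ℚ.≤-trans 1≤x (subst (_≤ x * x ^ n) (ℚ.*-identityʳ x)
  (*-monoˡ (ℚ.≤-trans (ι-nonNeg 1) 1≤x) (^-≥1 1≤x n)))

-- Serves, with `x = 1/m` and `k = m`, to show that `m` factors of `1 + 1/m` make at least 2.
bernoulli : ∀ {x} → 0ℚ ≤ x → ∀ k → 1ℚ + ι k * x ≤ (1ℚ + x) ^ k
bernoulli {x} _ zero = ℚ.≤-reflexive (trans (cong (λ z → 1ℚ + z) (ℚ.*-zeroˡ x)) (ℚ.+-identityʳ 1ℚ))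
bernoulli {x} 0≤x (suc k) = begin
  1ℚ + ι (1 ℕ.+ k) * x                  ≡⟨ cong (λ z → 1ℚ + z * x) (ι-+ 1 k) ⟩
  1ℚ + (1ℚ + ι k) * x                   ≡⟨ ℚ.+-identityʳ _ ⟨
  1ℚ + (1ℚ + ι k) * x + 0ℚ              ≤⟨ ℚ.+-monoʳ-≤ (1ℚ + (1ℚ + ι k) * x)
                                             (*-nonNeg (*-nonNeg (ι-nonNeg k) 0≤x) 0≤x) ⟩
  1ℚ + (1ℚ + ι k) * x + ι k * x * x     ≡⟨ solve 2 (λ k x → con 1ℚ :+ (con 1ℚ :+ k) :* x :+ k :* x :* x
                                             := (con 1ℚ :+ x) :* (con 1ℚ :+ k :* x)) refl (ι k) x ⟩
  (1ℚ + x) * (1ℚ + ι k * x)             ≤⟨ *-monoˡ (ℚ.+-mono-≤ (ι-nonNeg 1) 0≤x) (bernoulli 0≤x k) ⟩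
  (1ℚ + x) * (1ℚ + x) ^ k               ∎
  where open ℚ.≤-Reasoning
        open +-*-Solver

2^n≤x^n : ∀ {x} → ι 2 ≤ x → ∀ n → ι (2 ℕ.^ n) ≤ x ^ n
2^n≤x^n 2≤x zero = ℚ.≤-refl
2^n≤x^n {x} 2≤x (suc n) = begin
  ι (2 ℕ.* 2 ℕ.^ n)                   ≡⟨ cong (λ z → ι (2 ℕ.^ n ℕ.+ z)) (ℕ.+-identityʳ _) ⟩
  ι (2 ℕ.^ n ℕ.+ 2 ℕ.^ n)             ≡⟨ ι-+ (2 ℕ.^ n) _ ⟩
  ι (2 ℕ.^ n) + ι (2 ℕ.^ n)           ≡⟨ solve 1 (λ y → y :+ y := con (ι 2) :* y) refl (ι (2 ℕ.^ n)) ⟩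
  ι 2 * ι (2 ℕ.^ n)                   ≤⟨ *-monoʳ (ι-nonNeg (2 ℕ.^ n)) 2≤x ⟩
  x * ι (2 ℕ.^ n)                     ≤⟨ *-monoˡ (ℚ.≤-trans (ι-nonNeg 2) 2≤x) (2^n≤x^n 2≤x n) ⟩
  x * x ^ n                           ∎
  where open ℚ.≤-Reasoning
        open +-*-Solver

-- `p` is a doubling time of `x`: the first `p * j` factors double `j` times, and the remaining ones
-- are at least 1. It is applied to `4/3` with `p = 3` and to `ρ` with `p = m`.
2^j≤x^k : ∀ {x} p j {k} → 1ℚ ≤ x → ι 2 ≤ x ^ p → p ℕ.* j ℕ.≤ k → ι (2 ℕ.^ j) ≤ x ^ k
2^j≤x^k {x} p j {k} 1≤x 2≤x^p pj≤k = begin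
  ι (2 ℕ.^ j)                            ≤⟨ 2^n≤x^n 2≤x^p j ⟩
  (x ^ p) ^ j                            ≡⟨ ^-assocʳ x p j ⟩
  x ^ (p ℕ.* j)                          ≡⟨ ℚ.*-identityʳ _ ⟨
  x ^ (p ℕ.* j) * 1ℚ                     ≤⟨ *-monoˡ (^-nonNeg (ℚ.≤-trans (ι-nonNeg 1) 1≤x) (p ℕ.* j))
                                              (^-≥1 1≤x (k ∸ p ℕ.* j)) ⟩
  x ^ (p ℕ.* j) * x ^ (k ∸ p ℕ.* j)      ≡⟨ ^-homo-* x (p ℕ.* j) _ ⟨
  x ^ (p ℕ.* j ℕ.+ (k ∸ p ℕ.* j))        ≡⟨ cong (x ^_) (ℕ.m+[n∸m]≡n pj≤k) ⟩
  x ^ k                                  ∎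
  where open ℚ.≤-Reasoning

½^d*2^d : ∀ d → ½ ^ d * ι (2 ℕ.^ d) ≡ 1ℚ
½^d*2^d zero = refl
½^d*2^d (suc d) = begin
  ½ * ½ ^ d * ι (2 ℕ.* 2 ℕ.^ d)
    ≡⟨ cong (λ z → ½ * ½ ^ d * z) (trans (cong (λ z → ι (2 ℕ.^ d ℕ.+ z)) (ℕ.+-identityʳ _)) (ι-+ (2 ℕ.^ d) _)) ⟩
  ½ * ½ ^ d * (ι (2 ℕ.^ d) + ι (2 ℕ.^ d))
    ≡⟨ solve 2 (λ x y → con ½ :* x :* (y :+ y) := x :* y) refl (½ ^ d) (ι (2 ℕ.^ d)) ⟩
  ½ ^ d * ι (2 ℕ.^ d)
    ≡⟨ ½^d*2^d d ⟩
  1ℚ ∎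
  where open ≡-Reasoning
        open +-*-Solver

-- The stopping rule

-- Once k ≥ threshold d, (4/3)^k ≥ 8 · 2^d because 3 (d + 3) ≤ k, and, for n ≤ 2d,
-- (n/(n-1))^k ≥ 8n because (n-1) (⌊log₂ d⌋ + 5) ≤ k.

threshold : ℕ → ℕ
threshold d = 2 ℕ.* suc d ℕ.* (⌊log₂ d ⌋ ℕ.+ 5)

threshold-mono-≤ : ∀ {a b} → a ℕ.≤ b → threshold a ℕ.≤ threshold b
threshold-mono-≤ a≤b = ℕ.*-mono-≤ (ℕ.*-monoʳ-≤ 2 (s≤s a≤b)) (ℕ.+-monoˡ-≤ 5 (⌊log₂⌋-mono-≤ a≤b))

n<2^[1+log₂n] : ∀ n → n ℕ.< 2 ℕ.^ suc ⌊log₂ n ⌋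
n<2^[1+log₂n] n = ℕ.≰⇒> λ 2^≤n → ℕ.1+n≰n
  (subst (ℕ._≤ ⌊log₂ n ⌋) (⌊log₂[2^n]⌋≡n (suc ⌊log₂ n ⌋)) (⌊log₂⌋-mono-≤ 2^≤n))

-- The constant is 2 · 2 · 6: `n + 1 ≤ 2n`, and `l + 5 ≤ 6l` because `n ≥ 2` makes the floored
-- logarithm `l` at least 1.
threshold-≤ : ∀ n → 2 ℕ.≤ n → threshold n ℕ.≤ 24 ℕ.* (n ℕ.* ⌊log₂ n ⌋)
threshold-≤ n 2≤n = begin
  2 ℕ.* suc n ℕ.* (l ℕ.+ 5)       ≤⟨ ℕ.*-mono-≤ (ℕ.*-monoʳ-≤ 2 n+1≤2n) l+5≤6l ⟩
  2 ℕ.* (2 ℕ.* n) ℕ.* (6 ℕ.* l)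
    ≡⟨ solve 2 (λ n l → con 2 :* (con 2 :* n) :* (con 6 :* l) := con 24 :* (n :* l)) refl n l ⟩
  24 ℕ.* (n ℕ.* l)                ∎
  where
  open ℕ.≤-Reasoning
  open N
  l = ⌊log₂ n ⌋
  1≤l : 1 ℕ.≤ l
  1≤l = ⌊log₂⌋-mono-≤ 2≤n
  n+1≤2n : suc n ℕ.≤ 2 ℕ.* n
  n+1≤2n = ℕ.≤-trans (ℕ.+-monoˡ-≤ n (ℕ.≤-trans (s≤s z≤n) 2≤n))
    (ℕ.≤-reflexive (cong (n ℕ.+_) (sym (ℕ.+-identityʳ n))))
  l+5≤6l : l ℕ.+ 5 ℕ.≤ 6 ℕ.* l
  l+5≤6l = ℕ.+-monoʳ-≤ l (ℕ.*-monoʳ-≤ 5 1≤l)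

-- The failure potential

⅛ 4/3 : ℚ
⅛   = + 1 / 8
4/3 = + 4 / 3

module Potential (m : ℕ) .{{_ : NonZero m}} where

  n : ℕ
  n = suc m

  -- The ratio n/(n-1), reciprocal to a missing item's chance of surviving a draw; the form
  -- `1 + 1/m` fits `bernoulli`.
  ρ : ℚ
  ρ = 1ℚ + (+ 1 / m)

  early late failure : ℕ → ℕ → ℚ
  early k d with 2 ℕ.* d ℕ.≤? n
  ... | yes _ = ⅛ * (½ ^ d * 4/3 ^ k)
  ... | no  _ = 0ℚ
  late k d = ⅛ * (+ 1 / n) * (ι (n ∸ d) * ρ ^ k)
  failure k d = early k d + late k d

  ⅛-nonNeg : 0ℚ ≤ ⅛
  ⅛-nonNeg = 1/n-nonNeg 8

  ρ*ιm : ρ * ι m ≡ ι n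
  ρ*ιm = begin
    (1ℚ + (+ 1 / m)) * ι m        ≡⟨ ℚ.*-distribʳ-+ (ι m) 1ℚ (+ 1 / m) ⟩
    1ℚ * ι m + (+ 1 / m) * ι m    ≡⟨ cong₂ _+_ (ℚ.*-identityˡ (ι m)) (1/n*ιn m) ⟩
    ι m + 1ℚ                      ≡⟨ ℚ.+-comm (ι m) 1ℚ ⟩
    1ℚ + ι m                      ≡⟨ ι-+ 1 m ⟨
    ι n                           ∎
    where open ≡-Reasoning

  1≤ρ : 1ℚ ≤ ρ
  1≤ρ = subst (_≤ ρ) (ℚ.+-identityʳ 1ℚ) (ℚ.+-monoʳ-≤ 1ℚ (1/n-nonNeg m))

  ρ^k-nonNeg : ∀ k → 0ℚ ≤ ρ ^ k
  ρ^k-nonNeg = ^-nonNeg (ℚ.≤-trans (ι-nonNeg 1) 1≤ρ)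

  2≤ρ^m : ι 2 ≤ ρ ^ m
  2≤ρ^m = subst (_≤ ρ ^ m) (cong (λ z → 1ℚ + z) (trans (ℚ.*-comm (ι m) (+ 1 / m)) (1/n*ιn m)))
    (bernoulli (1/n-nonNeg m) m)

  early-term-nonNeg : ∀ k d → 0ℚ ≤ ⅛ * (½ ^ d * 4/3 ^ k)
  early-term-nonNeg k d = *-nonNeg ⅛-nonNeg
    (*-nonNeg (^-nonNeg (1/n-nonNeg 2) d) (^-nonNeg (ℚ.nonNegative⁻¹ 4/3) k))

  early-nonNeg : ∀ k d → 0ℚ ≤ early k d
  early-nonNeg k d with 2 ℕ.* d ℕ.≤? n
  ... | yes _ = early-term-nonNeg k d
  ... | no  _ = ℚ.≤-refl

  early-≤ : ∀ k d → early k d ≤ ⅛ * (½ ^ d * 4/3 ^ k)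
  early-≤ k d with 2 ℕ.* d ℕ.≤? n
  ... | yes _ = ℚ.≤-refl
  ... | no  _ = early-term-nonNeg k d

  late-nonNeg : ∀ k d → 0ℚ ≤ late k d
  late-nonNeg k d = *-nonNeg (*-nonNeg ⅛-nonNeg (1/n-nonNeg n)) (*-nonNeg (ι-nonNeg (n ∸ d)) (ρ^k-nonNeg k))

  failure-nonNeg : ∀ k d → 0ℚ ≤ failure k d
  failure-nonNeg k d = ℚ.+-mono-≤ (early-nonNeg k d) (late-nonNeg k d)

  -- Both sides are multiplied by `n`: `d` of the equally likely items are repeats and `e` are new.
  -- A repeat scales the uncut term by 4/3 and a new item by 2/3, and `(4d + 2e)/3 ≤ d + e` exactly
  -- when `d ≤ e`, which is `2d ≤ n`. Cutting off can only lower the left side further. Beyond the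
  -- cut-off everything is 0, since `d` never decreases.
  early-superharmonic : ∀ k {d e} → d ℕ.+ e ≡ n →
    ι d * early (suc k) d + ι e * early (suc k) (suc d) ≤ ι n * early k d
  early-superharmonic k {d} {e} d+e≡n with 2 ℕ.* d ℕ.≤? n | early-≤ (suc k) (suc d)
  ... | no 2d≰n | _ with 2 ℕ.* suc d ℕ.≤? n
  ...   | yes 2d+2≤n = contradiction (ℕ.≤-trans (ℕ.*-monoʳ-≤ 2 (ℕ.n≤1+n d)) 2d+2≤n) 2d≰n
  ...   | no _ = ℚ.≤-reflexive (solve 3 (λ d e n → d :* con 0ℚ :+ e :* con 0ℚ := n :* con 0ℚ) refl
                                     (ι d) (ι e) (ι n))
    where open +-*-Solver
  early-superharmonic k {d} {e} d+e≡n | yes 2d≤n | le = begin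
    ι d * (⅛ * (½ ^ d * (4/3 * 4/3 ^ k))) + ι e * early (suc k) (suc d)
      ≤⟨ ℚ.+-monoʳ-≤ (ι d * (⅛ * (½ ^ d * (4/3 * 4/3 ^ k)))) (*-monoˡ (ι-nonNeg e) le) ⟩
    ι d * (⅛ * (½ ^ d * (4/3 * 4/3 ^ k))) + ι e * (⅛ * (½ * ½ ^ d * (4/3 * 4/3 ^ k)))
      ≡⟨ solve 4 (λ d e x y →
           d :* (con ⅛ :* (x :* (con 4/3 :* y))) :+ e :* (con ⅛ :* (con ½ :* x :* (con 4/3 :* y)))
             := (con ⅛ :* (x :* y)) :* (con (+ 1 / 3) :* d)
                :+ (con ⅛ :* (x :* y)) :* (d :+ con (+ 2 / 3) :* e))
           refl (ι d) (ι e) (½ ^ d) (4/3 ^ k) ⟩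
    X * ((+ 1 / 3) * ι d) + X * (ι d + (+ 2 / 3) * ι e)
      ≤⟨ ℚ.+-monoˡ-≤ _ (*-monoˡ (early-term-nonNeg k d) (*-monoˡ (1/n-nonNeg 3) (ι-mono-≤ d≤e))) ⟩
    X * ((+ 1 / 3) * ι e) + X * (ι d + (+ 2 / 3) * ι e)
      ≡⟨ solve 3 (λ d e x → x :* (con (+ 1 / 3) :* e) :+ x :* (d :+ con (+ 2 / 3) :* e) := (d :+ e) :* x) refl
           (ι d) (ι e) X ⟩
    (ι d + ι e) * X
      ≡⟨ cong (_* X) (trans (sym (ι-+ d e)) (cong ι d+e≡n)) ⟩
    ι n * X ∎
    where
    open ℚ.≤-Reasoning
    open +-*-Solver
    X = ⅛ * (½ ^ d * 4/3 ^ k)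
    d≤e : d ℕ.≤ e
    d≤e = ℕ.+-cancelˡ-≤ d d e (subst₂ ℕ._≤_ (cong (d ℕ.+_) (ℕ.+-identityʳ d)) (sym d+e≡n) 2d≤n)

  -- With `e` items missing, `d` of the draws leave `e` missing and the other `e` leave `e - 1`. The
  -- weighted count is `e (d + e - 1) = e (n - 1)`, and the extra factor `ρ` turns `n - 1` into `n`.
  -- The case `e = 0` is split off because of the predecessor.
  late-harmonic : ∀ k {d e} → d ℕ.+ e ≡ n →
    ι d * late (suc k) d + ι e * late (suc k) (suc d) ≡ ι n * late k d
  late-harmonic k {d} {zero} d+0≡n
    rewrite trans (sym (ℕ.+-identityʳ d)) d+0≡n | ℕ.n∸n≡0 m =
    solve 5 (λ n u r x l → n :* (u :* (con 0ℚ :* (r :* x))) :+ con 0ℚ :* l := n :* (u :* (con 0ℚ :* x))) refl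
      (ι n) (⅛ * (+ 1 / n)) ρ (ρ ^ k) (late (suc k) (suc n))
    where open +-*-Solver
  late-harmonic k {d} {suc e} d+e≡n = begin
    ι d * (u * (ι (n ∸ d) * (ρ * R))) + ι (suc e) * (u * (ι (n ∸ suc d) * (ρ * R)))
      ≡⟨ cong₂ (λ a b → ι d * (u * (ι a * (ρ * R))) + ι (suc e) * (u * (ι b * (ρ * R)))) n∸d≡1+e m∸d≡e ⟩
    ι d * (u * (ι (suc e) * (ρ * R))) + ι (suc e) * (u * (ι e * (ρ * R)))
      ≡⟨ solve 6 (λ d e u f ρ R → d :* (u :* (f :* (ρ :* R))) :+ f :* (u :* (e :* (ρ :* R)))
           := (ρ :* (d :+ e)) :* (u :* (f :* R))) refl (ι d) (ι e) u (ι (suc e)) ρ R ⟩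
    ρ * (ι d + ι e) * (u * (ι (suc e) * R))
      ≡⟨ cong₂ (λ a b → ρ * a * (u * (ι b * R))) (trans (sym (ι-+ d e)) (cong ι d+e≡m)) (sym n∸d≡1+e) ⟩
    ρ * ι m * late k d
      ≡⟨ cong (_* late k d) ρ*ιm ⟩
    ι n * late k d ∎
    where
    open ≡-Reasoning
    open +-*-Solver
    u = ⅛ * (+ 1 / n)
    R = ρ ^ k
    d+e≡m : d ℕ.+ e ≡ m
    d+e≡m = ℕ.suc-injective (trans (sym (ℕ.+-suc d e)) d+e≡n)
    m∸d≡e : m ∸ d ≡ e
    m∸d≡e = trans (cong (_∸ d) (sym d+e≡m)) (ℕ.m+n∸m≡n d e)
    n∸d≡1+e : n ∸ d ≡ suc e
    n∸d≡1+e = trans (cong (_∸ d) (sym d+e≡n)) (ℕ.m+n∸m≡n d (suc e))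

  failure-superharmonic : ∀ k {d e} → d ℕ.+ e ≡ n →
    ι d * failure (suc k) d + ι e * failure (suc k) (suc d) ≤ ι n * failure k d
  failure-superharmonic k {d} {e} d+e≡n = begin
    ι d * (a + b) + ι e * (a′ + b′)
      ≡⟨ solve 6 (λ d e a b a′ b′ → d :* (a :+ b) :+ e :* (a′ :+ b′)
           := (d :* a :+ e :* a′) :+ (d :* b :+ e :* b′)) refl (ι d) (ι e) a b a′ b′ ⟩
    (ι d * a + ι e * a′) + (ι d * b + ι e * b′)
      ≤⟨ ℚ.+-mono-≤ (early-superharmonic k {d} {e} d+e≡n) (ℚ.≤-reflexive (late-harmonic k {d} {e} d+e≡n)) ⟩
    ι n * early k d + ι n * late k d
      ≡⟨ ℚ.*-distribˡ-+ (ι n) (early k d) (late k d) ⟨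
    ι n * failure k d ∎
    where
    open ℚ.≤-Reasoning
    open +-*-Solver
    a = early (suc k) d
    b = late (suc k) d
    a′ = early (suc k) (suc d)
    b′ = late (suc k) (suc d)

  failure-at-threshold : ∀ {k d} → d ℕ.< n → threshold d ℕ.≤ k → 1ℚ ≤ failure k d
  failure-at-threshold {k} {d} d<n T≤k with 2 ℕ.* d ℕ.≤? n
  ... | yes _ = begin
    1ℚ                                 ≡⟨ ½^d*2^d (3 ℕ.+ d) ⟨
    (½ * (½ * (½ * ½ ^ d))) * ι (2 ℕ.^ (3 ℕ.+ d))
      ≡⟨ solve 2 (λ x y → con ½ :* (con ½ :* (con ½ :* x)) :* y := con ⅛ :* (x :* y)) refl
           (½ ^ d) (ι (2 ℕ.^ (3 ℕ.+ d))) ⟩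
    ⅛ * (½ ^ d * ι (2 ℕ.^ (3 ℕ.+ d)))
      -- `4/3 ^ 3 = 64/27` is at least 2, so three draws pay for one doubling; `3 + d` doublings
      -- absorb the factor `⅛ * ½ ^ d`.
      ≤⟨ *-monoˡ ⅛-nonNeg (*-monoˡ (^-nonNeg (1/n-nonNeg 2) d)
           (2^j≤x^k {4/3} 3 (3 ℕ.+ d) {k} (toWitness {a? = 1ℚ ℚ.≤? 4/3} _) (toWitness {a? = ι 2 ℚ.≤? 4/3 ^ 3} _)
             (ℕ.≤-trans 3[3+d]≤T T≤k))) ⟩
    ⅛ * (½ ^ d * 4/3 ^ k)              ≡⟨ ℚ.+-identityʳ _ ⟨
    ⅛ * (½ ^ d * 4/3 ^ k) + 0ℚ         ≤⟨ ℚ.+-monoʳ-≤ (⅛ * (½ ^ d * 4/3 ^ k)) (late-nonNeg k d) ⟩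
    ⅛ * (½ ^ d * 4/3 ^ k) + late k d   ∎
    where
    open ℚ.≤-Reasoning
    open +-*-Solver
    3[3+d]≤T : 3 ℕ.* (3 ℕ.+ d) ℕ.≤ threshold d
    3[3+d]≤T = ℕ.≤-trans
      (ℕ.≤-trans (ℕ.m≤m+n (3 ℕ.* (3 ℕ.+ d)) (1 ℕ.+ 7 ℕ.* d))
        (ℕ.≤-reflexive (N.solve 1 (λ d → N.con 3 N.:* (N.con 3 N.:+ d) N.:+ (N.con 1 N.:+ N.con 7 N.:* d)
                                      N.:= N.con 2 N.:* (N.con 1 N.:+ d) N.:* N.con 5) refl d)))
      (ℕ.*-monoʳ-≤ (2 ℕ.* suc d) (ℕ.m≤n+m 5 ⌊log₂ d ⌋))
  ... | no 2d≰n = begin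
    1ℚ                        ≡⟨ 1/n*ιn n ⟨
    (+ 1 / n) * ι n           ≡⟨ solve 2 (λ u x → u :* x := con ⅛ :* u :* (con 1ℚ :* (con (ι 8) :* x))) refl
                                   (+ 1 / n) (ι n) ⟩
    ⅛ * (+ 1 / n) * (1ℚ * (ι 8 * ι n))
      ≤⟨ *-monoˡ u-nonNeg (*-monoˡ (ι-nonNeg 1) 8n≤ρ^k) ⟩
    ⅛ * (+ 1 / n) * (1ℚ * ρ ^ k)
      ≤⟨ *-monoˡ u-nonNeg (*-monoʳ (ρ^k-nonNeg k) (ι-mono-≤ (ℕ.m<n⇒0<n∸m d<n))) ⟩
    late k d                  ≡⟨ ℚ.+-identityˡ _ ⟨
    0ℚ + late k d             ∎
    where
    open ℚ.≤-Reasoning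
    open +-*-Solver
    u-nonNeg = *-nonNeg ⅛-nonNeg (1/n-nonNeg n)
    j = ⌊log₂ d ⌋ ℕ.+ 5
    n≤2d : n ℕ.≤ 2 ℕ.* d
    n≤2d = ℕ.<⇒≤ (ℕ.≰⇒> 2d≰n)
    mj≤k : m ℕ.* j ℕ.≤ k
    mj≤k = ℕ.≤-trans (ℕ.*-monoˡ-≤ j (ℕ.≤-trans (ℕ.n≤1+n m) (ℕ.≤-trans n≤2d (ℕ.*-monoʳ-≤ 2 (ℕ.n≤1+n d))))) T≤k
    -- The summand 5 in `threshold` comes from here: `8n ≤ 16d ≤ 32 * 2 ^ ⌊log₂ d ⌋`.
    8n≤2^j : 8 ℕ.* n ℕ.≤ 2 ℕ.^ j
    8n≤2^j = ℕ.≤-trans (ℕ.*-monoʳ-≤ 8 (ℕ.≤-trans n≤2d (ℕ.*-monoʳ-≤ 2 (ℕ.<⇒≤ (n<2^[1+log₂n] d)))))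
      (ℕ.≤-reflexive (trans (N.solve 1 (λ x → N.con 8 N.:* (N.con 2 N.:* (N.con 2 N.:* x)) N.:= x N.:* N.con 32) refl
          (2 ℕ.^ ⌊log₂ d ⌋))
        (sym (ℕ.^-distribˡ-+-* 2 ⌊log₂ d ⌋ 5))))
    8n≤ρ^k : ι 8 * ι n ≤ ρ ^ k
    8n≤ρ^k = ℚ.≤-trans (ℚ.≤-reflexive (sym (ι-* 8 n))) (ℚ.≤-trans (ι-mono-≤ 8n≤2^j) (2^j≤x^k m j 1≤ρ 2≤ρ^m mj≤k))

  failure-start : failure 0 0 ≡ + 1 / 4
  failure-start = begin
    ⅛ * (1ℚ * 1ℚ) + ⅛ * (+ 1 / n) * (ι n * 1ℚ)
      ≡⟨ solve 2 (λ u x → con ⅛ :* (con 1ℚ :* con 1ℚ) :+ con ⅛ :* u :* (x :* con 1ℚ) 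
           := con ⅛ :+ con ⅛ :* (u :* x)) refl (+ 1 / n) (ι n) ⟩
    ⅛ + ⅛ * ((+ 1 / n) * ι n)
      ≡⟨ cong (λ z → ⅛ + ⅛ * z) (1/n*ιn n) ⟩
    + 1 / 4 ∎
    where open ≡-Reasoning
          open +-*-Solver

-- All that the analysis of the algorithm uses of the potential. Superharmonicity is stated after
-- multiplication by `n`, hence without division, and `initial` is the failure probability that
-- success 2/3 allows.
record FailurePotential (n : ℕ) : Set where
  field
    Φ             : ℕ → ℕ → ℚ
    nonNeg        : ∀ k d → 0ℚ ≤ Φ k d
    at-threshold  : ∀ {k d} → d ℕ.< n → threshold d ℕ.≤ k → 1ℚ ≤ Φ k d
    superharmonic : ∀ k {d e} → d ℕ.+ e ≡ n → ι d * Φ (suc k) d + ι e * Φ (suc k) (suc d) ≤ ι n * Φ k d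
    initial       : Φ 0 0 ≤ + 1 / 3

failurePotential : ∀ n → 2 ℕ.≤ n → FailurePotential n
failurePotential (suc zero) (s≤s ())
failurePotential (suc (suc m)) _ = record
  { Φ = failure
  ; nonNeg = failure-nonNeg
  ; at-threshold = failure-at-threshold
  ; superharmonic = failure-superharmonic
  ; initial = subst (_≤ + 1 / 3) (sym failure-start) (toWitness {a? = + 1 / 4 ℚ.≤? + 1 / 3} _)
  }
  -- `n ≥ 2` makes `n - 1 = suc m` nonzero, so that `ρ` is defined.
  where open Potential (suc m)

-- Sums over Fin n and lists without repetitions

module Σℚ = Sum ℚ.+-0-commutativeMonoid

Σ[_] : ∀ {n} → (Fin n → ℚ) → ℚ
Σ[_] = Σℚ.sum

sum-mono : ∀ {n} {f g : Fin n → ℚ} → (∀ i → f i ≤ g i) → Σ[ f ] ≤ Σ[ g ]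
sum-mono {zero}  f≤g = ℚ.≤-refl
sum-mono {suc n} f≤g = ℚ.+-mono-≤ (f≤g zero) (sum-mono (f≤g ∘ suc))

sum-const : ∀ n x → Σ[ (λ (_ : Fin n) → x) ] ≡ ι n * x
sum-const zero    x = sym (ℚ.*-zeroˡ x)
sum-const (suc n) x = begin
  x + Σ[ (λ (_ : Fin n) → x) ]   ≡⟨ cong₂ _+_ (sym (ℚ.*-identityˡ x)) (sum-const n x) ⟩
  1ℚ * x + ι n * x               ≡⟨ ℚ.*-distribʳ-+ x 1ℚ (ι n) ⟨
  (1ℚ + ι n) * x                 ≡⟨ cong (_* x) (ι-+ 1 n) ⟨
  ι (suc n) * x                  ∎
  where open ≡-Reasoning

sum-single : ∀ {n} (j : Fin n) x → Σ[ (λ i → if does (i Fin.≟ j) then x else 0ℚ) ] ≡ x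
sum-single {suc n} zero x = trans (cong (λ z → x + z) (trans (sum-const n 0ℚ) (ℚ.*-zeroʳ (ι n)))) (ℚ.+-identityʳ x)
sum-single {suc n} (suc j) x = trans (ℚ.+-identityˡ _) (sum-single j x)

module _ {n : ℕ} where

  open DecMembership (Fin._≟_ {n}) using (_∈?_)

  -- Starting from `b` at all `n` indices, each entry of the list corrects one index by `a - b`;
  -- without repetitions no index is corrected twice.
  sum-membership : ∀ {xs} → Unique xs → ∀ a b →
    Σ[ (λ i → if does (i ∈? xs) then a else b) ] ≡ ι n * b + ι (length xs) * (a - b)
  sum-membership [] a b = trans (sum-const n b)
    (solve 3 (λ n a b → n :* b := n :* b :+ con 0ℚ :* (a :- b)) refl (ι n) a b)
    where open +-*-Solver
  sum-membership {x ∷ xs} (x∉xs ∷ uxs) a b = begin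
    Σ[ (λ i → if does (i ∈? (x ∷ xs)) then a else b) ]
      ≡⟨ Σℚ.sum-cong-≗ split ⟩
    Σ[ (λ i → (if does (i ∈? xs) then a else b) + (if does (i Fin.≟ x) then a - b else 0ℚ)) ]
      ≡⟨ Σℚ.∑-distrib-+ (λ i → if does (i ∈? xs) then a else b) (λ i → if does (i Fin.≟ x) then a - b else 0ℚ) ⟩
    Σ[ (λ i → if does (i ∈? xs) then a else b) ] + Σ[ (λ i → if does (i Fin.≟ x) then a - b else 0ℚ) ]
      ≡⟨ cong₂ _+_ (sum-membership uxs a b) (sum-single x (a - b)) ⟩
    ι n * b + ι (length xs) * (a - b) + (a - b)
      ≡⟨ solve 3 (λ s l c → s :+ l :* c :+ c := s :+ (con 1ℚ :+ l) :* c) refl (ι n * b) (ι (length xs)) (a - b) ⟩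
    ι n * b + (1ℚ + ι (length xs)) * (a - b)
      ≡⟨ cong (λ z → ι n * b + z * (a - b)) (ι-+ 1 (length xs)) ⟨
    ι n * b + ι (suc (length xs)) * (a - b) ∎
    where
    open ≡-Reasoning
    open +-*-Solver
    split : ∀ i → (if does (i ∈? (x ∷ xs)) then a else b) ≡
                  (if does (i ∈? xs) then a else b) + (if does (i Fin.≟ x) then a - b else 0ℚ)
    split i with i Fin.≟ x | i ∈? xs
    ... | yes refl | yes x∈xs = contradiction refl (All.lookup x∉xs x∈xs)
    ... | yes _    | no _     = solve 2 (λ a b → a := b :+ (a :- b)) refl a b
    ... | no _     | yes _    = sym (ℚ.+-identityʳ a)
    ... | no _     | no _     = sym (ℚ.+-identityʳ b)

  lookup-injective : ∀ {xs : List (Fin n)} → Unique xs → ∀ {i j} → lookup xs i ≡ lookup xs j → i ≡ j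
  lookup-injective (_ ∷ _)    {zero}  {zero}  _  = refl
  lookup-injective (x∉ ∷ _)   {zero}  {suc j} eq = contradiction eq (All.lookup x∉ (∈.∈-lookup j))
  lookup-injective (x∉ ∷ _)   {suc i} {zero}  eq = contradiction (sym eq) (All.lookup x∉ (∈.∈-lookup i))
  lookup-injective (_ ∷ uxs)  {suc i} {suc j} eq = cong suc (lookup-injective uxs eq)

  unique-length-≤ : ∀ {xs : List (Fin n)} → Unique xs → length xs ℕ.≤ n
  unique-length-≤ uxs = Fin.injective⇒≤ (lookup-injective uxs)

  -- Membership is tested in `ys` while `xs` is extended: midway through the comparisons only some
  -- of the known items remain to be tested.
  add : Fin n → List (Fin n) → List (Fin n) → List (Fin n)
  add i ys xs = if does (i ∈? ys) then xs else i ∷ xs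

  add-∷ : ∀ i y ys xs → add i (y ∷ ys) xs ≡ (if ⌊ i Fin.≟ y ⌋ then xs else add i ys xs)
  add-∷ i y ys xs with i Fin.≟ y
  ... | yes _ = refl
  ... | no  _ = refl

  add-unique : ∀ i {xs} → Unique xs → Unique (add i xs xs)
  add-unique i {xs} uxs with i ∈? xs
  ... | yes _   = uxs
  ... | no i∉xs = All.¬Any⇒All¬ xs i∉xs ∷ uxs

  unique-complete : ∀ {xs} → Unique xs → length xs ≡ n → ∀ i → i ∈ xs
  unique-complete {xs} uxs len i with i ∈? xs
  ... | yes i∈xs = i∈xs
  ... | no i∉xs  = contradiction
    (subst (ℕ._< n) len (unique-length-≤ {i ∷ xs} (All.¬Any⇒All¬ xs i∉xs ∷ uxs))) (ℕ.<-irrefl refl)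

  -- The transition law of the number of distinct items under one uniform draw, before division by
  -- `n`: the indices in the list leave the number as it is, and the others raise it by one.
  sum-add : ∀ {xs} → Unique xs → ∀ (h : ℕ → ℚ) →
    Σ[ (λ i → h (length (add i xs xs))) ] ≡
      ι n * h (suc (length xs)) + ι (length xs) * (h (length xs) - h (suc (length xs)))
  sum-add {xs} uxs h = trans (Σℚ.sum-cong-≗ eq) (sum-membership uxs _ _)
    where
    eq : ∀ i → h (length (add i xs xs)) ≡ (if does (i ∈? xs) then h (length xs) else h (suc (length xs)))
    eq i with i ∈? xs
    ... | yes _ = refl
    ... | no _  = refl

≃-reflexive : ∀ {x y} → (∀ k → approx x k ≡ approx y k) → x ≃ y
≃-reflexive {x} {y} eq ε 0<ε = 0 , λ k _ →
  subst (_< ε) (cong ∣_∣ (sym (trans (cong (_- approx y k) (eq k)) (ℚ.+-inverseʳ (approx y k))))) 0<ε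

approx-sumℝ : ∀ xs k → approx (sumℝ xs) k ≡ foldr _+_ 0ℚ (map (λ x → approx x k) xs)
approx-sumℝ []       k = refl
approx-sumℝ (x ∷ xs) k = cong (λ z → approx x k + z) (approx-sumℝ xs k)

-- The moduli may depend on the order of summation, so the two reals are compared approximation by
-- approximation, where the sums are ordinary ones in `ℚ`.
sumℝ-↭ : ∀ {xs ys} → xs ↭ ys → sumℝ xs ≃ sumℝ ys
sumℝ-↭ {xs} {ys} xs↭ys = ≃-reflexive {sumℝ xs} {sumℝ ys} λ k → begin
  approx (sumℝ xs) k                          ≡⟨ approx-sumℝ xs k ⟩
  foldr _+_ 0ℚ (map (λ x → approx x k) xs)
    ≡⟨ foldr-commMonoid (setoid ℚ) ℚ.+-0-isCommutativeMonoid (↭⇒↭ₛ (↭.map⁺ (λ x → approx x k) xs↭ys)) ⟩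
  foldr _+_ 0ℚ (map (λ x → approx x k) ys)    ≡⟨ approx-sumℝ ys k ⟨
  approx (sumℝ ys) k                          ∎
  where open ≡-Reasoning

-- The algorithm

Found : ℕ → Set
Found k = List (Fin k × ℝ)

-- `reps` holds one sample per distinct item found. In `compare`, the newest sample, of weight `x`,
-- is to be tested against `j` and then against `js`; at least one candidate is kept because such a
-- state must perform a test.
data State : ℕ → Set where
  ready   : ∀ {k} → Found k → State k
  compare : ∀ {k} → ℝ → Found (suc k) → Fin (suc k) → List (Fin (suc k)) → State (suc k)

compareWith : ∀ {k} → ℝ → Found (suc k) → List (Fin (suc k)) → State (suc k)
compareWith x reps []       = ready ((zero , x) ∷ reps)
compareWith x reps (j ∷ js) = compare x reps j js

shift : ∀ {k} → Found k → Found (suc k)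
shift = map λ (i , x) → suc i , x

-- The stopping rule sees only the number of draws and the representatives found, never `n`. The
-- decision is an argument, so that case analysis on it makes `next` compute.
proceed : ∀ {k} (reps : Found k) → Dec (threshold (length reps) ℕ.≤ k) → Action UniformOnly State k
proceed reps (yes _) = return reps
proceed reps (no  _) = draw uniform refl λ x → compareWith x (shift reps) (map proj₁ (shift reps))

next : ∀ {k} → State k → Action UniformOnly State k
next {k} (ready reps)      = proceed reps (threshold (length reps) ℕ.≤? k)
next (compare x reps j js) = test zero j λ same → if same then ready reps else compareWith x reps js

collector : Algorithm UniformOnly
collector = record { State = State ; start = ready [] ; next = next }

-- The analysis

module Analysis (I : Instance) (2≤n : 2 ℕ.≤ size I) where

  open Instance I hiding (size)
  open Execution collector I
  open FailurePotential (failurePotential (size I) 2≤n)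

  n : ℕ
  n = size I

  instance
    n≢0 : NonZero n
    n≢0 = ℕ.>-nonZero (ℕ.≤-trans (s≤s z≤n) 2≤n)

  -- Averages and expectations over seeds.

  ιn*mean : ∀ {m} (f : Fin m → ℚ) → ι m * mean f ≡ Σ[ f ]
  -- The default value 0 of the empty mean agrees with the empty sum.
  ιn*mean {zero}  f = refl
  ιn*mean {suc m} f = begin
    ι (suc m) * ((+ 1 / suc m) * Σ[ f ])   ≡⟨ ℚ.*-assoc (ι (suc m)) (+ 1 / suc m) Σ[ f ] ⟨
    ι (suc m) * (+ 1 / suc m) * Σ[ f ]     ≡⟨ cong (_* Σ[ f ])
                                                (trans (ℚ.*-comm (ι (suc m)) (+ 1 / suc m)) (1/n*ιn (suc m))) ⟩
    1ℚ * Σ[ f ]                            ≡⟨ ℚ.*-identityˡ _ ⟩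
    Σ[ f ]                                 ∎
    where open ≡-Reasoning

  ιn-positive : Positive (ι n)
  ιn-positive = ℚ.normalize-pos n 1

  mean-≤ : ∀ {f : Fin n → ℚ} {x} → (∀ i → f i ≤ x) → mean f ≤ x
  mean-≤ {f} {x} f≤x = ℚ.*-cancelˡ-≤-pos (ι n) {{ιn-positive}} (begin
    ι n * mean f               ≡⟨ ιn*mean f ⟩
    Σ[ f ]                     ≤⟨ sum-mono f≤x ⟩
    Σ[ (λ (_ : Fin n) → x) ]   ≡⟨ sum-const n x ⟩
    ι n * x                    ∎)
    where open ℚ.≤-Reasoning

  ≤-mean : ∀ {f : Fin n → ℚ} {x} → ι n * x ≤ Σ[ f ] → x ≤ mean f
  ≤-mean {f} {x} le = ℚ.*-cancelˡ-≤-pos (ι n) {{ιn-positive}} (subst (ι n * x ≤_) (sym (ιn*mean f)) le)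

  average : ∀ x → ½ * (x + x) ≡ x
  average = solve 1 (λ x → con ½ :* (x :+ x) := x) refl
    where open +-*-Solver

  𝔼-≤ : ∀ t {f : Vec Seed t → ℚ} {x} → (∀ ω → f ω ≤ x) → 𝔼 t f ≤ x
  𝔼-≤ zero    f≤x = f≤x []
  𝔼-≤ (suc t) {x = x} f≤x = mean-≤ λ i → subst (_ ≤_) (average x)
    (*-monoˡ (1/n-nonNeg 2) (ℚ.+-mono-≤ (𝔼-≤ t λ ω → f≤x ((item i , true) ∷ ω))
                                           (𝔼-≤ t λ ω → f≤x ((item i , false) ∷ ω))))

  -- `g` depends on the drawn item alone, so averaging over the coin leaves it unchanged and only a
  -- sum over items remains.
  ≤-𝔼 : ∀ t {f : Vec Seed (suc t) → ℚ} {x} (g : Fin n → ℚ) →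
        (∀ i b → g i ≤ 𝔼 t (λ ω → f ((item i , b) ∷ ω))) → ι n * x ≤ Σ[ g ] → x ≤ 𝔼 (suc t) f
  ≤-𝔼 t g g≤𝔼 le = ≤-mean (ℚ.≤-trans le (sum-mono λ i →
    subst (_≤ _) (average (g i)) (*-monoˡ (1/n-nonNeg 2) (ℚ.+-mono-≤ (g≤𝔼 i true) (g≤𝔼 i false)))))

  -- What a configuration has found, and the invariant of a run.

  index : U → Fin n
  index = Inverse.from enum

  index-item : ∀ i → index (item i) ≡ i
  index-item = Inverse.strictlyInverseʳ enum

  item-index : ∀ a → item (index a) ≡ a
  item-index = Inverse.strictlyInverseˡ enum

  indexAt : ∀ {k} → Vec U k → Fin k → Fin n
  indexAt as i = index (Vec.lookup as i)

  indices : ∀ {k} → Vec U k → Found k → List (Fin n)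
  indices as = map λ (i , _) → indexAt as i

  -- While a sample is being compared, `seen` already contains its item, so that
  -- tests leave `seen` unchanged.

  seen : Config → List (Fin n)
  seen (config as (ready reps))          = indices as reps
  seen (config as (compare x reps j js)) = add (indexAt as zero) (map (indexAt as) (j ∷ js)) (indices as reps)

  WeightsOf : ∀ {k} → Vec U k → Found k → Set
  WeightsOf as = All λ (i , x) → x ≡ weight (Vec.lookup as i)

  Weighted : Config → Set
  Weighted (config as (ready reps))          = WeightsOf as reps
  Weighted (config as (compare x reps j js)) = x ≡ weight (Vec.lookup as zero) × WeightsOf as reps

  pending : Config → ℕ
  pending (config as (ready reps))          = 0
  pending (config as (compare x reps j js)) = suc (length js)

  -- `seen-unique` keeps the number of items found at most `n`; `drawn-≤` holds on every run, so the
  -- sample bound is a worst-case one.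
  record Invariant (c : Config) : Set where
    constructor invariant
    field
      seen-unique : Unique (seen c)
      weighted    : Weighted c
      drawn-≤     : drawn c ℕ.≤ threshold n

  seen-compareWith : ∀ {k} (as : Vec U (suc k)) x reps js →
    seen (config as (compareWith x reps js)) ≡ add (indexAt as zero) (map (indexAt as) js) (indices as reps)
  seen-compareWith as x reps []       = refl
  seen-compareWith as x reps (j ∷ js) = refl

  weighted-compareWith : ∀ {k} (as : Vec U (suc k)) {x reps} js →
    x ≡ weight (Vec.lookup as zero) → WeightsOf as reps → Weighted (config as (compareWith x reps js))
  weighted-compareWith as []      eq ws = eq ∷ ws
  weighted-compareWith as (_ ∷ _) eq ws = eq , ws

  pending-compareWith : ∀ {k} (as : Vec U (suc k)) x reps js →
    pending (config as (compareWith x reps js)) ≡ length js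
  pending-compareWith as x reps []       = refl
  pending-compareWith as x reps (j ∷ js) = refl

  afterDraw : ∀ {k} → Vec U k → Found k → U → Config
  afterDraw as reps a = config (a ∷ as) (compareWith (weight a) (shift reps) (map proj₁ (shift reps)))

  step-halted : ∀ {k} (as : Vec U k) reps → threshold (length reps) ℕ.≤ k → ∀ s →
    step (config as (ready reps)) s ≡ config as (ready reps)
  step-halted {k} as reps T≤k s with threshold (length reps) ℕ.≤? k
  ... | yes _  = refl
  ... | no T≰k = contradiction T≤k T≰k

  step-draw : ∀ {k} (as : Vec U k) reps → ¬ threshold (length reps) ℕ.≤ k → ∀ a b →
    step (config as (ready reps)) (a , b) ≡ afterDraw as reps a
  step-draw {k} as reps T≰k a b with threshold (length reps) ℕ.≤? k
  ... | yes T≤k = contradiction T≤k T≰k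
  ... | no _    = refl

  indices-shift : ∀ {k} a (as : Vec U k) reps → indices (a ∷ as) (shift reps) ≡ indices as reps
  indices-shift a as reps = sym (List.map-∘ reps)

  -- A fresh sample is to be tested against all representatives, so both lists of `add` coincide and
  -- the drawn index performs one coupon-collector step.
  seen-afterDraw : ∀ {k} (as : Vec U k) reps a →
    seen (afterDraw as reps a) ≡ add (index a) (indices as reps) (indices as reps)
  seen-afterDraw as reps a = begin
    seen (afterDraw as reps a)
      ≡⟨ seen-compareWith (a ∷ as) (weight a) (shift reps) (map proj₁ (shift reps)) ⟩
    add (index a) (map (indexAt (a ∷ as)) (map proj₁ (shift reps))) (indices (a ∷ as) (shift reps))
      ≡⟨ cong (λ ys → add (index a) ys (indices (a ∷ as) (shift reps))) (List.map-∘ (shift reps)) ⟨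
    add (index a) (indices (a ∷ as) (shift reps)) (indices (a ∷ as) (shift reps))
      ≡⟨ cong (λ ys → add (index a) ys ys) (indices-shift a as reps) ⟩
    add (index a) (indices as reps) (indices as reps) ∎
    where open ≡-Reasoning

  pending-afterDraw : ∀ {k} (as : Vec U k) reps a → pending (afterDraw as reps a) ≡ length (indices as reps)
  pending-afterDraw as reps a = begin
    pending (afterDraw as reps a)         ≡⟨ pending-compareWith (a ∷ as) (weight a) (shift reps) _ ⟩
    length (map proj₁ (shift reps))       ≡⟨ List.length-map proj₁ (shift reps) ⟩
    length (shift reps)                   ≡⟨ List.length-map _ reps ⟩
    length reps                           ≡⟨ List.length-map _ reps ⟨
    length (indices as reps)              ∎
    where open ≡-Reasoning

  -- By `add-∷`: a match shows the item to be known already, a mismatch removes one candidate, and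
  -- neither changes the list.
  seen-step-compare : ∀ {k} (as : Vec U (suc k)) x reps j js s →
    seen (step (config as (compare x reps j js)) s) ≡ seen (config as (compare x reps j js))
  seen-step-compare as x reps j js s =
    trans lemma (sym (add-∷ (indexAt as zero) (indexAt as j) (map (indexAt as) js) (indices as reps)))
    where
    lemma : seen (config as (if sameItem (Vec.lookup as zero) (Vec.lookup as j)
      then ready reps else compareWith x reps js)) ≡
            (if sameItem (Vec.lookup as zero) (Vec.lookup as j) then indices as reps
             else add (indexAt as zero) (map (indexAt as) js) (indices as reps))
    lemma with sameItem (Vec.lookup as zero) (Vec.lookup as j)
    ... | true  = refl
    ... | false = seen-compareWith as x reps js

  -- The threshold of the current number of items is at most that of `n`, by monotonicity.
  -- Strictness leaves room for the next draw.
  drawn-<-threshold : ∀ {k} {as : Vec U k} {reps} → Unique (indices as reps) →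
    ¬ threshold (length reps) ℕ.≤ k → k ℕ.< threshold n
  drawn-<-threshold {as = as} {reps} u T≰k = ℕ.<-≤-trans (ℕ.≰⇒> T≰k)
    (threshold-mono-≤ (subst (ℕ._≤ n) (List.length-map _ reps) (unique-length-≤ u)))

  step-invariant : ∀ {c} → Invariant c → ∀ s → Invariant (step c s)
  step-invariant {config {k} as (ready reps)} inv@(invariant u ws k≤T) (a , b) with threshold (length reps) ℕ.≤? k
  ... | yes _  = inv
  ... | no T≰k = invariant
    (subst Unique (sym (seen-afterDraw as reps a)) (add-unique (index a) u))
    (weighted-compareWith (a ∷ as) (map proj₁ (shift reps)) refl (All.map⁺ ws))
    (drawn-<-threshold {as = as} {reps} u T≰k)
  step-invariant {c@(config as (compare x reps j js))} (invariant u (eq , ws) k≤T) s =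
    invariant (subst Unique (sym (seen-step-compare as x reps j js s)) u) ws′ k≤T
    where
    ws′ : Weighted (config as (if sameItem (Vec.lookup as zero) (Vec.lookup as j)
      then ready reps else compareWith x reps js))
    ws′ with sameItem (Vec.lookup as zero) (Vec.lookup as j)
    ... | true  = ws
    ... | false = weighted-compareWith as js eq ws

  run-invariant : ∀ {t c} → Invariant c → ∀ (ω : Vec Seed t) → Invariant (runFrom c ω)
  run-invariant inv []      = inv
  run-invariant inv (s ∷ ω) = run-invariant (step-invariant inv s) ω

  init : Config
  init = config [] (ready [])

  init-invariant : Invariant init
  init-invariant = invariant [] [] z≤n

  -- Correctness of the output.

  complete : Config → Bool
  complete (config {k} as (ready reps)) = ⌊ threshold (length reps) ℕ.≤? k ⌋ ∧ ⌊ length reps ℕ.≟ n ⌋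
  complete (config as (compare _ _ _ _)) = false

  -- By pigeonhole `n` distinct items exhaust `U`, so the returned items permute the enumeration;
  -- the stored weights equal the true ones, so the total agrees too.
  wholeSet : ∀ {k} (as : Vec U k) reps → Unique (indices as reps) → WeightsOf as reps → length reps ≡ n →
    IsWholeSet (map (λ (i , x) → Vec.lookup as i , x) reps)
  wholeSet as reps u ws len = record
    { unique   = subst Unique (sym items≡) items-unique
    ; complete = λ a → subst (a ∈_) (sym items≡) (items-complete a)
    ; weights  = All.map⁺ (All.map (λ {p} eq →
                   ≃-reflexive {proj₂ p} {weight (Vec.lookup as (proj₁ p))} (λ k → cong (λ x → approx x k) eq)) ws)
    ; total    = subst₂ (λ xs ys → sumℝ xs ≃ sumℝ ys) (sym weights≡) (List.map-tabulate item weight)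
                   (sumℝ-↭ (↭.map⁺ weight items↭))
    }
    where
    pairs = map (λ (i , x) → Vec.lookup as i , x) reps
    items = map (λ (i , _) → Vec.lookup as i) reps
    items≡ : map proj₁ pairs ≡ items
    items≡ = sym (List.map-∘ reps)
    indices≡ : indices as reps ≡ map index items
    indices≡ = List.map-∘ reps
    items-unique : Unique items
    items-unique = Unique.map⁻ (subst Unique indices≡ u)
    items-complete : ∀ a → a ∈ items
    items-complete a
      with b , b∈ , eq ← ∈.∈-map⁻ index (subst (index a ∈_) indices≡
             (unique-complete u (trans (List.length-map _ reps) len) (index a)))
      = subst (_∈ items) (trans (sym (item-index b)) (trans (cong item (sym eq)) (item-index a))) b∈
    items↭ : items ↭ tabulate item
    items↭ = ∼bag⇒↭ (unique∧set⇒bag items-unique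
      (Unique.tabulate⁺ (λ {i} {j} eq → trans (sym (index-item i)) (trans (cong index eq) (index-item j))))
      (λ {a} → mk⇔ (λ _ → subst (_∈ tabulate item) (item-index a) (∈.∈-tabulate⁺ (index a)))
                   (λ _ → items-complete a)))
    weights≡ : map proj₂ pairs ≡ map weight items
    weights≡ = trans (sym (List.map-∘ reps)) (trans (All-map≡ ws) (List.map-∘ reps))
      where
      All-map≡ : ∀ {reps} → WeightsOf as reps → map proj₂ reps ≡ map (λ (i , _) → weight (Vec.lookup as i)) reps
      All-map≡ []         = refl
      All-map≡ (eq ∷ eqs) = cong₂ _∷_ eq (All-map≡ eqs)

  complete⇒returns : ∀ c → Invariant c → T (complete c) → ReturnsWholeSet c
  complete⇒returns (config {k} as (ready reps)) (invariant u ws _) done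
    with threshold (length reps) ℕ.≤? k | length reps ℕ.≟ n
  ... | yes _ | yes len = reps , refl , wholeSet as reps u ws len

  -- A draw is followed by at most n comparisons, so a round takes at most suc n steps.

  fuel : Config → ℕ
  fuel c = (threshold n ∸ drawn c) ℕ.* suc n ℕ.+ pending c

  -- Lower bound for the success probability.

  indicator : Bool → ℚ
  indicator b = if b then 1ℚ else 0ℚ

  bound : Config → ℚ
  bound c = 1ℚ - Φ (drawn c) (length (seen c))

  1-≤ : ∀ {x y} → x ≤ y → 1ℚ - y ≤ 1ℚ - x
  1-≤ x≤y = ℚ.+-monoʳ-≤ 1ℚ (ℚ.neg-antimono-≤ x≤y)

  -- If all items are found, the indicator is 1 and `Φ ≥ 0`; if one is missing, `Φ ≥ 1` and the
  -- bound is at most 0.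
  halted-bound : ∀ {k} (as : Vec U k) reps → Invariant (config as (ready reps)) → threshold (length reps) ℕ.≤ k →
    bound (config as (ready reps)) ≤ indicator (complete (config as (ready reps)))
  halted-bound {k} as reps (invariant u _ _) T≤k with threshold (length reps) ℕ.≤? k | length reps ℕ.≟ n
  ... | no T≰k | _      = contradiction T≤k T≰k
  ... | yes _  | yes _  = 1-≤ (nonNeg k _)
  ... | yes _  | no len = 1-≤ (at-threshold
          (ℕ.≤∧≢⇒< (unique-length-≤ u) (len ∘ trans (sym (List.length-map _ reps))))
          (subst (λ d → threshold d ℕ.≤ k) (sym (List.length-map _ reps)) T≤k))

  successProbability : ℕ → Config → ℚ
  successProbability t c = 𝔼 t (λ ω → indicator (complete (runFrom c ω)))

  ≤-successProbability : ∀ t c {x} (g : Fin n → ℚ) →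
    (∀ i b → g i ≤ successProbability t (step c (item i , b))) → ι n * x ≤ Σ[ g ] → x ≤ successProbability (suc t) c
  ≤-successProbability t c = ≤-𝔼 t {λ ω → indicator (complete (runFrom c ω))}

  ≤-successProbability-const : ∀ t c → (∀ s → bound c ≤ successProbability t (step c s)) →
    bound c ≤ successProbability (suc t) c
  ≤-successProbability-const t c le =
    ≤-successProbability t c (λ _ → bound c) (λ i b → le (item i , b)) (ℚ.≤-reflexive (sym (sum-const n (bound c))))

  success-halted : ∀ t {k} (as : Vec U k) reps → Invariant (config as (ready reps)) →
    threshold (length reps) ℕ.≤ k →
    bound (config as (ready reps)) ≤ successProbability t (config as (ready reps))
  success-halted zero    as reps inv T≤k = halted-bound as reps inv T≤k
  success-halted (suc t) as reps inv T≤k = ≤-successProbability-const t c λ s →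
    subst (λ c′ → bound c ≤ successProbability t c′) (sym (step-halted as reps T≤k s)) (success-halted t as reps inv T≤k)
    where c = config as (ready reps)

  -- Induction on the remaining time, with enough fuel to reach a halt. A test changes neither the
  -- number of draws nor `seen`, hence not `bound`; a draw does not lower `bound` on average, by
  -- superharmonicity. Splitting on the decision passed to `success-ready` leaves
  -- `successProbability` in the goal untouched.
  success : ∀ t c → Invariant c → fuel c ℕ.≤ t → bound c ≤ successProbability t c
  success-ready : ∀ t {k} (as : Vec U k) reps → Invariant (config as (ready reps)) →
    Dec (threshold (length reps) ℕ.≤ k) → fuel (config as (ready reps)) ℕ.≤ t →
    bound (config as (ready reps)) ≤ successProbability t (config as (ready reps))

  success t (config as (ready reps)) inv fuel≤t = success-ready t as reps inv (_ ℕ.≤? _) fuel≤t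
  success zero c@(config as (compare x reps j js)) inv fuel≤0 =
    contradiction (ℕ.m+n≡0⇒n≡0 ((threshold n ∸ drawn c) ℕ.* suc n) {pending c} (ℕ.n≤0⇒n≡0 fuel≤0)) λ ()
  success (suc t) c@(config {k} as (compare x reps j js)) inv fuel≤ = ≤-successProbability-const t c λ s →
    ℚ.≤-trans
      (ℚ.≤-reflexive (cong (λ xs → 1ℚ - Φ k (length xs)) (sym (seen-step-compare as x reps j js s))))
      (success t (step c s) (step-invariant inv s) (fuel-step s))
    where
    pending-step : ∀ s → pending (step c s) ℕ.≤ length js
    pending-step s with sameItem (Vec.lookup as zero) (Vec.lookup as j)
    ... | true  = z≤n
    ... | false = ℕ.≤-reflexive (pending-compareWith as x reps js)
    fuel-step : ∀ s → fuel (step c s) ℕ.≤ t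
    fuel-step s = ℕ.≤-pred (begin
      suc ((threshold n ∸ k) ℕ.* suc n ℕ.+ pending (step c s))
        ≤⟨ s≤s (ℕ.+-monoʳ-≤ ((threshold n ∸ k) ℕ.* suc n) (pending-step s)) ⟩
      suc ((threshold n ∸ k) ℕ.* suc n ℕ.+ length js)
        ≡⟨ ℕ.+-suc _ (length js) ⟨
      fuel c
        ≤⟨ fuel≤ ⟩
      suc t ∎)
      where open ℕ.≤-Reasoning

  success-ready t as reps inv (yes T≤k) _ = success-halted t as reps inv T≤k
  success-ready zero {k} as reps (invariant u _ _) (no T≰k) fuel≤0 =
    contradiction (ℕ.<-≤-trans (ℕ.m<n⇒0<n∸m (drawn-<-threshold {as = as} {reps} u T≰k))
      (ℕ.≤-trans (ℕ.m≤m*n (threshold n ∸ k) (suc n)) (ℕ.≤-trans (ℕ.m≤m+n _ 0) fuel≤0))) λ ()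
  success-ready (suc t) {k} as reps inv@(invariant u _ _) (no T≰k) fuel≤ =
    ≤-successProbability t c (λ i → h (length (add i S S))) next≤ superharmonic′
    where
    S = indices as reps
    h : ℕ → ℚ
    h d = 1ℚ - Φ (suc k) d
    d = length S
    e = n ∸ d
    c = config as (ready reps)
    fuel-afterDraw : ∀ a → fuel (afterDraw as reps a) ℕ.≤ t
    fuel-afterDraw a = ℕ.≤-pred (begin
      suc ((threshold n ∸ suc k) ℕ.* suc n ℕ.+ pending (afterDraw as reps a))
        ≡⟨ ℕ.+-suc _ _ ⟨
      (threshold n ∸ suc k) ℕ.* suc n ℕ.+ suc (pending (afterDraw as reps a))
        ≤⟨ ℕ.+-monoʳ-≤ _ (s≤s (subst (ℕ._≤ n) (sym (pending-afterDraw as reps a)) (unique-length-≤ u))) ⟩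
      (threshold n ∸ suc k) ℕ.* suc n ℕ.+ suc n
        ≡⟨ ℕ.+-comm _ (suc n) ⟩
      suc (threshold n ∸ suc k) ℕ.* suc n
        -- Truncated subtraction drops by exactly one here because `k < threshold n`.
        ≡⟨ cong (ℕ._* suc n) (sym (ℕ.+-∸-assoc 1 (drawn-<-threshold {as = as} {reps} u T≰k))) ⟩
      (threshold n ∸ k) ℕ.* suc n
        ≤⟨ ℕ.m≤m+n _ 0 ⟩
      fuel c
        ≤⟨ fuel≤ ⟩
      suc t ∎)
      where open ℕ.≤-Reasoning
    next≤ : ∀ i b → h (length (add i S S)) ≤ successProbability t (step c (item i , b))
    next≤ i b = subst₂ (λ j c′ → h (length (add j S S)) ≤ successProbability t c′)
      (index-item i) (sym (step-draw as reps T≰k (item i) b))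
      (ℚ.≤-trans (ℚ.≤-reflexive (cong (h ∘ length) (sym (seen-afterDraw as reps (item i)))))
        (success t (afterDraw as reps (item i))
          (subst Invariant (step-draw as reps T≰k (item i) b) (step-invariant inv (item i , b)))
          (fuel-afterDraw (item i))))
    d+e≡n : d ℕ.+ e ≡ n
    d+e≡n = ℕ.m+[n∸m]≡n (unique-length-≤ u)
    superharmonic′ : ι n * (1ℚ - Φ k d) ≤ Σ[ (λ i → h (length (add i S S))) ]
    superharmonic′ = begin
      ι n * (1ℚ - Φ k d)
        ≡⟨ solve 2 (λ n p → n :* (con 1ℚ :- p) := n :- n :* p) refl (ι n) (Φ k d) ⟩
      ι n - ι n * Φ k d
        -- Superharmonicity of `Φ` with the sign reversed; the rest rewrites
        -- `d * h d + e * h (suc d)` into the form of `sum-add`.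
        ≤⟨ ℚ.+-monoʳ-≤ (ι n) (ℚ.neg-antimono-≤ (superharmonic k {d} {e} d+e≡n)) ⟩
      ι n - (ι d * Φ (suc k) d + ι e * Φ (suc k) (suc d))
        ≡⟨ cong (λ z → z - (ι d * Φ (suc k) d + ι e * Φ (suc k) (suc d))) ιn≡ ⟩
      (ι d + ι e) - (ι d * Φ (suc k) d + ι e * Φ (suc k) (suc d))
        ≡⟨ solve 4 (λ d e p q → (d :+ e) :- (d :* p :+ e :* q) 
             := (d :+ e) :* (con 1ℚ :- q) :+ d :* ((con 1ℚ :- p) :- (con 1ℚ :- q)))
             refl (ι d) (ι e) (Φ (suc k) d) (Φ (suc k) (suc d)) ⟩
      (ι d + ι e) * h (suc d) + ι d * (h d - h (suc d))
        ≡⟨ cong (λ z → z * h (suc d) + ι d * (h d - h (suc d))) ιn≡ ⟨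
      ι n * h (suc d) + ι d * (h d - h (suc d))
        ≡⟨ sum-add u h ⟨
      Σ[ (λ i → h (length (add i S S))) ] ∎
      where
      open ℚ.≤-Reasoning
      open +-*-Solver
      ιn≡ : ι n ≡ ι d + ι e
      ιn≡ = trans (cong ι (sym d+e≡n)) (ι-+ d e)

  -- The sample bound and the success probability of the algorithm.

  expected : ExpectedSamples≤ (24 ℕ.* (n ℕ.* ⌊log₂ n ⌋))
  expected t = 𝔼-≤ t λ ω → ι-mono-≤
    (ℕ.≤-trans (Invariant.drawn-≤ (run-invariant init-invariant ω)) (threshold-≤ n 2≤n))

  -- `complete` supplies the required Boolean event. The time `fuel init` does not depend on `ε`:
  -- the lower bound 2/3 is already reached there, and `ε` is given away.
  eventually : EventuallyWithProbability≥ (+ 2 / 3) ReturnsWholeSet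
  eventually ε 0<ε = t , complete ∘ run ,
    (λ ω → complete⇒returns (run ω) (run-invariant init-invariant ω)) , (begin
    + 2 / 3 - ε      ≤⟨ ℚ.+-monoʳ-≤ (+ 2 / 3) (ℚ.neg-antimono-≤ (ℚ.<⇒≤ 0<ε)) ⟩
    1ℚ - + 1 / 3     ≤⟨ 1-≤ initial ⟩
    bound init       ≤⟨ success t init init-invariant ℕ.≤-refl ⟩
    𝔼 t (λ ω → indicator (complete (run ω))) ∎)
    where
    open ℚ.≤-Reasoning
    t = fuel init

theorem12 : Σ (Algorithm UniformOnly) λ 𝒜 → ∃[ C ]
    ((I : Instance) → 2 ℕ.≤ size I → let open Execution 𝒜 I in
    ExpectedSamples≤ (C ℕ.* (size I ℕ.* ⌊log₂ size I ⌋)) ×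
    EventuallyWithProbability≥ (+ 2 / 3) ReturnsWholeSet)
theorem12 = collector , 24 , λ I 2≤n → Analysis.expected I 2≤n , Analysis.eventually I 2≤n
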